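{- Let $G=(V,E,c)$ be a directed graph that admits a circulation $C\colon E\to\mathbb N$ with $C(e)\ge1$ for all $e\in E$. For any circulation $X\colon E\to\mathbb Z$ with $\Vert X\Vert\le1$, there exist circulations $A,B\colon E\to\mathbb Z$ such that: (1) $A,B\ge0$; (2) $X=A-B$; (3) $\tilde c(A)+\tilde c(B)\le\mathrm{mccc}(G)$.
   Context: $G=(V,E,c)$ is a directed graph with no sources and no sinks, with a cost function $c\colon E\to\mathbb R_{\ge0}$. A circulation is a function $X$ on $E$ such that at every node the sum of values on incoming edges equals the sum of values on outgoing edges. $\Vert X\Vert=\max_{e\in E}|X(e)|$. The cost of a circulation $Y$ is $\tilde c(Y)=\sum_{e\in E}c(e)Y(e)$. $\mathrm{mccc}(G)$ (minimum cost circulation cover) is the minimum of $\tilde c(C)$ over all integer circulations $C$ on $G$ with $C(e)\ge1$ for all $e\in E$. -}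

module Defs where

open import Algebra.Bundles using (CommutativeRing)
import Algebra.Definitions.RawMonoid as RawMonoidDefs
open import Data.Bool.Base using (if_then_else_)
open import Data.Fin.Base using (Fin)
open import Data.Fin.Properties using (_≟_)
open import Data.Integer.Base as ℤ using (ℤ; +_; -[1+_]; 0ℤ; 1ℤ; ∣_∣)
import Data.Integer.Properties as ℤ
open import Data.List.Base using (tabulate)
open import Data.List.Extrema.Nat using (max)
open import Data.Nat.Base using (ℕ; suc)
open import Data.Product.Base using (∃-syntax; _×_)
open import Function.Base using (_∘_)
open import Level using (Level; _⊔_) renaming (suc to lsuc)
open import Relation.Binary.Core using (Rel)
open import Relation.Binary.PropositionalEquality.Core using (_≡_)
open import Relation.Binary.Structures using (IsTotalOrder)
open import Relation.Nullary.Decidable.Core using (does)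

open import Algebra.Properties.Monoid.Sum ℤ.+-0-monoid using () renaming (sum to sumℤ)

-- The field of costs.  Nothing beyond the ordered field structure of the
-- real numbers is used, so ℝ is replaced by an arbitrary ordered field.
record OrderedField (c ℓ₁ ℓ₂ : Level) : Set (lsuc (c ⊔ ℓ₁ ⊔ ℓ₂)) where
  infix 4 _≤_
  field
    commutativeRing : CommutativeRing c ℓ₁

  open CommutativeRing commutativeRing public

  field
    _≤_          : Rel Carrier ℓ₂
    isTotalOrder : IsTotalOrder _≈_ _≤_
    1≉0          : 1# ≉ 0#
    inverse      : ∀ x → x ≉ 0# → ∃[ y ] x * y ≈ 1#
    +-monoˡ-≤    : ∀ z {x y} → x ≤ y → x + z ≤ y + z
    *-nonNeg     : ∀ {x y} → 0# ≤ x → 0# ≤ y → 0# ≤ x * y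

  open RawMonoidDefs +-rawMonoid public using (sum) renaming (_×_ to _·_)

  fromℤ : ℤ → Carrier
  fromℤ (+ n)    = n · 1#
  fromℤ -[1+ n ] = - (suc n · 1#)

module _ {c ℓ₁ ℓ₂ : Level} (R : OrderedField c ℓ₁ ℓ₂) where

  open OrderedField R using (Carrier; _≈_; _≤_; _*_; 0#; sum; fromℤ)

  -- Loops and parallel edges are allowed.
  record Graph : Set (c ⊔ ℓ₂) where
    field
      #V #E    : ℕ
      src tgt  : Fin #E → Fin #V
      cost     : Fin #E → Carrier
      cost≥0   : ∀ e → 0# ≤ cost e
      noSource : ∀ v → ∃[ e ] tgt e ≡ v
      noSink   : ∀ v → ∃[ e ] src e ≡ v

    Edge : Set
    Edge = Fin #E

    inflow outflow : (Edge → ℤ) → Fin #V → ℤ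
    inflow  X v = sumℤ λ e → if does (tgt e ≟ v) then X e else 0ℤ
    outflow X v = sumℤ λ e → if does (src e ≟ v) then X e else 0ℤ

    IsCirculation : (Edge → ℤ) → Set
    IsCirculation X = ∀ v → inflow X v ≡ outflow X v

    -- The base value 0 only matters for the graph without edges.
    ‖_‖ : (Edge → ℤ) → ℕ
    ‖ X ‖ = max 0 (tabulate (∣_∣ ∘ X))

    c̃ : (Edge → ℤ) → Carrier
    c̃ Y = sum λ e → cost e * fromℤ (Y e)

    IsCover : (Edge → ℤ) → Set
    IsCover C = IsCirculation C × (∀ e → 1ℤ ℤ.≤ C e)

    -- m is the minimum of c̃ over the covers, i.e. m = mccc(G); antisymmetry
    -- makes such an m unique up to _≈_.
    IsMccc : Carrier → Set (ℓ₁ ⊔ ℓ₂)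
    IsMccc m = (∃[ C ] IsCover C × c̃ C ≈ m) × (∀ C → IsCover C → m ≤ c̃ C)

{-# OPTIONS --safe #-}
-- Let C be a cheapest cover.  The edges on which C + X is odd meet every node
-- evenly often, so they have an Eulerian orientation: a circulation s with
-- values in {-1, 0, 1} and s ≡ C + X (mod 2).  Replacing s by - s if necessary,
-- c̃ s ≤ 0.  Then A = (C + X + s) / 2 and B = (C - X + s) / 2 are integral,
-- A - B = X and c̃ A + c̃ B = c̃ C + c̃ s ≤ c̃ C.  They are nonnegative because
-- 2 A and 2 B are at least 1 - 1 - 1 = -1.
module Submission where

open import Defs
open import Algebra.Bundles using (AbelianGroup)
import Algebra.Properties.CommutativeMonoid.Sum as CMSum
import Algebra.Properties.Group as GroupProperties
import Algebra.Properties.AbelianGroup as AbelianGroupProperties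
import Algebra.Properties.Monoid.Mult as Mult
import Algebra.Properties.CommutativeSemigroup as CommutativeSemigroupProperties
open import Data.Bool.Base using (Bool; true; false; if_then_else_)
open import Data.Fin.Base using (Fin; zero; suc; punchIn)
open import Data.Fin.Properties using (_≟_; any?; punchInᵢ≢i)
open import Data.Integer.Base as ℤ using (ℤ; +_; -[1+_]; 0ℤ; 1ℤ; -1ℤ; _⊖_; ∣_∣)
import Data.Integer.DivMod as ℤ
import Data.Integer.Properties as ℤ
open import Data.Integer.Divisibility.Signed as ℤ using (divides; _∣?_)
open import Data.Integer.Tactic.RingSolver using (solve-∀)
import Data.List.Relation.Unary.All.Properties as All
open import Data.List.Extrema.Nat using (xs≤max)
open import Data.Nat.Base as ℕ using (ℕ; zero; suc; z≤n; s≤s)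
import Data.Nat.Divisibility as ℕ
import Data.Nat.Properties as ℕ
open import Data.Product.Base using (Σ-syntax; ∃-syntax; _×_; _,_; proj₁; proj₂)
open import Data.Sum.Base using (_⊎_; inj₁; inj₂)
open import Data.Vec.Functional using (_∷_; updateAt; removeAt)
open import Data.Vec.Functional.Properties using (updateAt-updates; updateAt-minimal)
open import Function.Base using (_∘_; const)
open import Level using (Level)
open import Relation.Binary.Bundles using (Poset)
open import Relation.Binary.Structures using (IsTotalOrder)
import Relation.Binary.Reasoning.PartialOrder as PartialOrderReasoning
import Relation.Binary.Reasoning.Setoid as SetoidReasoning
open import Relation.Binary.PropositionalEquality.Core using (_≡_; _≢_; refl; sym; trans; cong; cong₂; subst)
open import Relation.Binary.PropositionalEquality.Properties using (module ≡-Reasoning)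
open import Relation.Nullary.Decidable.Core using (yes; no; does; ¬?; decidable-stable)
open import Relation.Nullary.Negation.Core using (¬_; contradiction)

open CMSum ℤ.+-0-commutativeMonoid
  using (∑-distrib-+; sum-cong-≗; sum-remove; sum-replicate-zero) renaming (sum to sumℤ)

private
  variable
    m n : ℕ

-- Parity of integers and of finite sums

Even : ℤ → Set
Even x = + 2 ℤ.∣ x

parity : ∀ x → Even x ⊎ ∃[ q ] x ≡ 1ℤ ℤ.+ q ℤ.* + 2
parity x with x ℤ.%ℕ 2 | x ℤ./ℕ 2 | ℤ.n%ℕd<d x 2 | ℤ.a≡a%ℕn+[a/ℕn]*n x 2
... | 0           | q | _                 | eq = inj₁ (divides q (trans eq (ℤ.+-identityˡ _)))
... | 1           | q | _                 | eq = inj₂ (q , eq)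
... | suc (suc _) | _ | s≤s (s≤s ()) | _

odd-odd : ∀ {x y} → ¬ Even x → ¬ Even y → Even (x ℤ.- y)
odd-odd {x} {y} x-odd y-odd with parity x | parity y
... | inj₁ x-even   | _             = contradiction x-even x-odd
... | _             | inj₁ y-even   = contradiction y-even y-odd
... | inj₂ (p , eq) | inj₂ (q , eq′) =
  divides (p ℤ.- q) (trans (cong₂ ℤ._-_ eq eq′) (difference p q))
  where
  difference : ∀ p q → (1ℤ ℤ.+ p ℤ.* + 2) ℤ.- (1ℤ ℤ.+ q ℤ.* + 2) ≡ (p ℤ.- q) ℤ.* + 2
  difference = solve-∀

1-odd : ¬ Even 1ℤ
1-odd 2∣1 = contradiction (ℕ.∣⇒≤ (ℤ.∣⇒∣ᵤ 2∣1)) λ { (s≤s ()) }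

sum-even : (f : Fin n → ℤ) → (∀ k → Even (f k)) → Even (sumℤ f)
sum-even {zero}  f _      = divides 0ℤ refl
sum-even {suc n} f f-even = ℤ.∣m∣n⇒∣m+n (f-even zero) (sum-even (f ∘ suc) (f-even ∘ suc))

-- Altering one edge, as `eulerian` does, thus costs a single correction term: splitting off the
-- index `j` leaves equal remainders.
sum-differ-at : (f g : Fin n → ℤ) (j : Fin n) → (∀ k → k ≢ j → f k ≡ g k) →
                sumℤ f ≡ sumℤ g ℤ.+ (f j ℤ.- g j)
sum-differ-at {suc n} f g j f≗g = begin
  sumℤ f                                   ≡⟨ sum-remove f ⟩
  f j ℤ.+ sumℤ (removeAt f j)              ≡⟨ cong (ℤ._+_ (f j)) (sum-cong-≗ λ k → f≗g (punchIn j k) (punchInᵢ≢i j k)) ⟩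
  f j ℤ.+ sumℤ (removeAt g j)              ≡⟨ shift (f j) (g j) _ ⟩
  (g j ℤ.+ sumℤ (removeAt g j)) ℤ.+ (f j ℤ.- g j)  ≡⟨ cong (ℤ._+ (f j ℤ.- g j)) (sum-remove g) ⟨
  sumℤ g ℤ.+ (f j ℤ.- g j)                 ∎
  where
  open ≡-Reasoning
  shift : ∀ a b c → a ℤ.+ c ≡ (b ℤ.+ c) ℤ.+ (a ℤ.- b)
  shift = solve-∀

-- Signed incidence, net flow and the fusion of two edges

δ : Fin m → Fin m → ℤ
δ a v = if does (a ≟ v) then 1ℤ else 0ℤ

-- The signed incidence column of an edge given as (tail , head); a loop has the zero column.
∂ : Fin m × Fin m → Fin m → ℤ
∂ (a , b) v = δ b v ℤ.- δ a v

-- Inflow minus outflow. As a product with `∂` it is visibly linear, and an edge can be replaced by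
-- changing its column.
net : (Fin n → Fin m × Fin m) → (Fin n → ℤ) → Fin m → ℤ
net e y v = sumℤ λ k → y k ℤ.* ∂ (e k) v

net-+ : (e : Fin n → Fin m × Fin m) (x y : Fin n → ℤ) (v : Fin m) →
        net e (λ k → x k ℤ.+ y k) v ≡ net e x v ℤ.+ net e y v
net-+ e x y v = trans (sum-cong-≗ λ k → ℤ.*-distribʳ-+ (∂ (e k) v) (x k) (y k))
                      (∑-distrib-+ (λ k → x k ℤ.* ∂ (e k) v) (λ k → y k ℤ.* ∂ (e k) v))

δ-refl : (v : Fin m) → δ v v ≡ 1ℤ
δ-refl v with v ≟ v
... | yes _   = refl
... | no v≢v = contradiction refl v≢v

δ-≢ : {a v : Fin m} → a ≢ v → δ a v ≡ 0ℤ
δ-≢ {a = a} {v} a≢v with a ≟ v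
... | yes a≡v = contradiction a≡v a≢v
... | no _    = refl

IsSign : ℤ → Set
IsSign σ = σ ≡ 1ℤ ⊎ σ ≡ -1ℤ

-- If neither end of `e` were `v`, its incidence at `v` would be 0, which is even. So `e` has an end
-- at `v`, and `w` is its other end. The walk from `b` through `v` to `w` traverses `e` forwards (σ
-- = 1) if `e` leaves `v`, and backwards (σ = -1) if it enters `v`; the contributions at `v`
-- telescope.
merge : (b v : Fin m) (e : Fin m × Fin m) → ¬ Even (∂ e v) →
        ∃[ w ] ∃[ σ ] IsSign σ × (∀ u → ∂ (b , w) u ≡ ∂ (b , v) u ℤ.+ σ ℤ.* ∂ e u)
merge b v (p , q) odd with p ≟ v | q ≟ v
... | yes refl | _ = q , 1ℤ , inj₁ refl , λ u → glue (δ q u) (δ b u) (δ p u)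
  where
  glue : ∀ x y z → x ℤ.- y ≡ (z ℤ.- y) ℤ.+ 1ℤ ℤ.* (x ℤ.- z)
  glue = solve-∀
... | no _ | yes refl = p , -1ℤ , inj₂ refl , λ u → glue (δ p u) (δ b u) (δ q u)
  where
  glue : ∀ x y z → x ℤ.- y ≡ (z ℤ.- y) ℤ.+ -1ℤ ℤ.* (z ℤ.- x)
  glue = solve-∀
... | no p≢v | no q≢v = contradiction (divides 0ℤ refl) odd

-- Roundings by parity and Eulerian orientations

infix 4 _Rounds_

-- For even `y` this forces `s` to be 0; for odd `y` it leaves 1 or -1, that is, an orientation of
-- the edge along or against its given direction.
record _Rounds_ (s y : ℤ) : Set where
  constructor _,_
  field
    small     : ∣ s ∣ ℕ.≤ 1
    congruent : Even (s ℤ.- y)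

open _Rounds_

rounds-0 : ∀ {y} → Even y → 0ℤ Rounds y
rounds-0 y-even = z≤n , ℤ.∣m∣n⇒∣m-n (divides 0ℤ refl) y-even

rounds-1 : ∀ {y} → ¬ Even y → 1ℤ Rounds y
rounds-1 y-odd = s≤s z≤n , odd-odd 1-odd y-odd

rounds-trans : ∀ {s y z} → s Rounds y → Even (y ℤ.- z) → s Rounds z
rounds-trans {s} {y} {z} (∣s∣≤1 , s-y) y-z =
  ∣s∣≤1 , subst Even (telescope s y z) (ℤ.∣m∣n⇒∣m+n s-y y-z)
  where
  telescope : ∀ s y z → (s ℤ.- y) ℤ.+ (y ℤ.- z) ≡ s ℤ.- z
  telescope = solve-∀

-- `s` and `- s` differ by `2 s`, so reversing an orientation keeps the parity.
rounds-neg : ∀ {s y} → s Rounds y → ℤ.- s Rounds y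
rounds-neg {s} {y} (∣s∣≤1 , s-y) =
  subst (ℕ._≤ 1) (sym (ℤ.∣-i∣≡∣i∣ s)) ∣s∣≤1 ,
  subst Even (reflect s y) (ℤ.∣m∣n⇒∣m-n s-y (divides s refl))
  where
  reflect : ∀ s y → (s ℤ.- y) ℤ.- s ℤ.* + 2 ≡ ℤ.- s ℤ.- y
  reflect = solve-∀

rounds-sign : ∀ {σ s y} → IsSign σ → s Rounds y → σ ℤ.* s Rounds y
rounds-sign {s = s} (inj₁ refl) r = subst (_Rounds _) (sym (ℤ.*-identityˡ s)) r
rounds-sign {s = s} (inj₂ refl) r = subst (_Rounds _) (sym (ℤ.-1*i≡-i s)) (rounds-neg r)

sign-1-even : ∀ {σ} → IsSign σ → Even (σ ℤ.- 1ℤ)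
sign-1-even (inj₁ refl) = divides 0ℤ refl
sign-1-even (inj₂ refl) = divides -1ℤ refl

-- Induction on the number of edges.  If the first edge (b , v) is odd and not a
-- loop, parity at v yields another odd edge with ends v and w; the two are
-- fused into a single edge (b , w), and both inherit its orientation.
eulerian : (e : Fin n → Fin m × Fin m) (y : Fin n → ℤ) → (∀ v → Even (net e y v)) →
           ∃[ s ] (∀ k → s k Rounds y k) × (∀ v → net e s v ≡ 0ℤ)
eulerian {zero} e y _ = (λ ()) , (λ ()) , λ _ → refl
eulerian {suc n} {m} e y even with + 2 ∣? y zero
-- An even edge changes no parity at any node, so it is dropped and receives 0.
... | yes y₀-even =
  let s , s-rounds , s-circ = eulerian (e ∘ suc) (y ∘ suc)
        (λ v → ℤ.∣m+n∣m⇒∣n (even v) (ℤ.∣m⇒∣m*n (∂ (e zero) v) y₀-even))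
  in  0ℤ ∷ s
    , (λ { zero → rounds-0 y₀-even ; (suc k) → s-rounds k })
    , (λ v → trans (ℤ.+-identityˡ _) (s-circ v))
... | no y₀-odd with proj₁ (e zero) ≟ proj₂ (e zero)
-- A loop contributes nothing to any net flow; either orientation would do, and 1 is chosen.
...   | yes b≡v =
  let s , s-rounds , s-circ = eulerian (e ∘ suc) (y ∘ suc)
        (λ u → ℤ.∣m+n∣m⇒∣n (even u) (ℤ.∣n⇒∣m*n (y zero) (subst Even (sym (loop u)) (divides 0ℤ refl))))
  in  1ℤ ∷ s
    , (λ { zero → rounds-1 y₀-odd ; (suc k) → s-rounds k })
    , (λ u → cong₂ ℤ._+_ (cong (1ℤ ℤ.*_) (loop u)) (s-circ u))
  where
  loop : ∀ u → ∂ (e zero) u ≡ 0ℤ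
  loop u = ℤ.i≡j⇒i-j≡0 (cong (λ a → δ a u) (sym b≡v))
...   | no b≢v with any? (λ k → ¬? (+ 2 ∣? (y (suc k) ℤ.* ∂ (e (suc k)) (proj₂ (e zero)))))
-- The first edge enters `v` with coefficient 1. If all other terms at `v` were even, the even total
-- would make `y zero` even.
...     | no none = contradiction y₀-even y₀-odd
  where
  v = proj₂ (e zero)
  end-v : ∂ (e zero) v ≡ 1ℤ
  end-v = cong₂ ℤ._-_ (δ-refl v) (δ-≢ b≢v)
  y₀-even : Even (y zero)
  y₀-even = subst Even (trans (cong (y zero ℤ.*_) end-v) (ℤ.*-identityʳ (y zero)))
    (ℤ.∣m+n∣n⇒∣m (even v)
      (sum-even _ λ k → decidable-stable (+ 2 ∣? _) λ odd → none (k , odd)))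
...     | yes (i , yᵢ∂ᵢ-odd) = lift (eulerian e′ (y ∘ suc) e′-even)
  where
  b  = proj₁ (e zero)
  v  = proj₂ (e zero)
  yᵢ = y (suc i)
  eᵢ = e (suc i)

  yᵢ-odd : ¬ Even yᵢ
  yᵢ-odd = yᵢ∂ᵢ-odd ∘ ℤ.∣m⇒∣m*n (∂ eᵢ v)

  merged : ∃[ w ] ∃[ σ ] IsSign σ × (∀ u → ∂ (b , w) u ≡ ∂ (b , v) u ℤ.+ σ ℤ.* ∂ eᵢ u)
  merged = merge b v eᵢ (yᵢ∂ᵢ-odd ∘ ℤ.∣n⇒∣m*n yᵢ)

  w = proj₁ merged
  σ = proj₁ (proj₂ merged)
  σ-sign = proj₁ (proj₂ (proj₂ merged))

  -- The fused edge takes over the index `i` and the weight `yᵢ`, so the weights of the smaller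
  -- instance are just `y ∘ suc`.
  e′ : Fin n → Fin m × Fin m
  e′ = updateAt (e ∘ suc) i (const (b , w))

  ∂e′ᵢ : ∀ u → ∂ (e′ i) u ≡ ∂ (e zero) u ℤ.+ σ ℤ.* ∂ eᵢ u
  ∂e′ᵢ u = begin
    ∂ (e′ i) u                         ≡⟨ cong (λ ab → ∂ ab u) (updateAt-updates i (e ∘ suc)) ⟩
    ∂ (b , w) u                        ≡⟨ proj₂ (proj₂ (proj₂ merged)) u ⟩
    ∂ (e zero) u ℤ.+ σ ℤ.* ∂ eᵢ u      ∎
    where open ≡-Reasoning

  -- Modulo 2, `yᵢ` agrees with `y zero` (both are odd) and σ with 1, so the fused edge contributes
  -- what the two old edges did. The last two terms of `net-e′` are these even discrepancies.
  e′-even : ∀ u → Even (net e′ (y ∘ suc) u)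
  e′-even u = subst Even (sym net-e′)
    (ℤ.∣m∣n⇒∣m+n (ℤ.∣m∣n⇒∣m+n (even u)
      (ℤ.∣m⇒∣m*n (∂ (e zero) u) (odd-odd yᵢ-odd y₀-odd)))
      (ℤ.∣m⇒∣m*n (yᵢ ℤ.* ∂ eᵢ u) (sign-1-even σ-sign)))
    where
    open ≡-Reasoning
    d₀ = ∂ (e zero) u
    dᵢ = ∂ eᵢ u
    rearrange : ∀ N y₀ yᵢ d₀ dᵢ σ →
      N ℤ.+ (yᵢ ℤ.* (d₀ ℤ.+ σ ℤ.* dᵢ) ℤ.- yᵢ ℤ.* dᵢ) ≡
      ((y₀ ℤ.* d₀ ℤ.+ N) ℤ.+ (yᵢ ℤ.- y₀) ℤ.* d₀) ℤ.+ (σ ℤ.- 1ℤ) ℤ.* (yᵢ ℤ.* dᵢ)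
    rearrange = solve-∀
    net-e′ : net e′ (y ∘ suc) u ≡
      (net e y u ℤ.+ (yᵢ ℤ.- y zero) ℤ.* d₀) ℤ.+ (σ ℤ.- 1ℤ) ℤ.* (yᵢ ℤ.* dᵢ)
    net-e′ = begin
      net e′ (y ∘ suc) u
        ≡⟨ sum-differ-at _ (λ k → y (suc k) ℤ.* ∂ (e (suc k)) u) i
             (λ k k≢i → cong (λ ab → y (suc k) ℤ.* ∂ ab u) (updateAt-minimal k i (e ∘ suc) k≢i)) ⟩
      net (e ∘ suc) (y ∘ suc) u ℤ.+ (yᵢ ℤ.* ∂ (e′ i) u ℤ.- yᵢ ℤ.* dᵢ)
        ≡⟨ cong (λ d → net (e ∘ suc) (y ∘ suc) u ℤ.+ (yᵢ ℤ.* d ℤ.- yᵢ ℤ.* dᵢ)) (∂e′ᵢ u) ⟩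
      net (e ∘ suc) (y ∘ suc) u ℤ.+ (yᵢ ℤ.* (d₀ ℤ.+ σ ℤ.* dᵢ) ℤ.- yᵢ ℤ.* dᵢ)
        ≡⟨ rearrange (net (e ∘ suc) (y ∘ suc) u) (y zero) yᵢ d₀ dᵢ σ ⟩
      (net e y u ℤ.+ (yᵢ ℤ.- y zero) ℤ.* d₀) ℤ.+ (σ ℤ.- 1ℤ) ℤ.* (yᵢ ℤ.* dᵢ) ∎

  -- The value `t i` of the fused edge is sent along the walk: `t i` on the first edge and `σ * t i`
  -- on edge `i`. Their combined column is exactly that of the fused edge, so the net flow is
  -- unchanged.
  lift : ∃[ s ] (∀ k → s k Rounds y (suc k)) × (∀ u → net e′ s u ≡ 0ℤ) →
         ∃[ s ] (∀ k → s k Rounds y k) × (∀ u → net e s u ≡ 0ℤ)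
  lift (t , t-rounds , t-circ) = t i ∷ t′ , rounds , circ
    where
    t′ : Fin n → ℤ
    t′ = updateAt t i (σ ℤ.*_)

    rounds : ∀ k → (t i ∷ t′) k Rounds y k
    rounds zero = rounds-trans (t-rounds i) (odd-odd yᵢ-odd y₀-odd)
    rounds (suc k) with k ≟ i
    ... | yes refl = subst (_Rounds _) (sym (updateAt-updates i t)) (rounds-sign σ-sign (t-rounds i))
    ... | no k≢i   = subst (_Rounds _) (sym (updateAt-minimal k i t k≢i)) (t-rounds k)

    circ : ∀ u → net e (t i ∷ t′) u ≡ 0ℤ
    circ u = begin
      t i ℤ.* d₀ ℤ.+ net (e ∘ suc) t′ u
        ≡⟨ cong (ℤ._+_ (t i ℤ.* d₀)) (sum-differ-at _ (λ k → t k ℤ.* ∂ (e′ k) u) i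
             (λ k k≢i → cong₂ (λ x ab → x ℤ.* ∂ ab u) (updateAt-minimal k i t k≢i)
                                (sym (updateAt-minimal k i (e ∘ suc) k≢i)))) ⟩
      t i ℤ.* d₀ ℤ.+ (net e′ t u ℤ.+ (t′ i ℤ.* dᵢ ℤ.- t i ℤ.* ∂ (e′ i) u))
        ≡⟨ cong₂ (λ x d → t i ℤ.* d₀ ℤ.+ (net e′ t u ℤ.+ (x ℤ.* dᵢ ℤ.- t i ℤ.* d)))
                 (updateAt-updates i t) (∂e′ᵢ u) ⟩
      t i ℤ.* d₀ ℤ.+ (net e′ t u ℤ.+ (σ ℤ.* t i ℤ.* dᵢ ℤ.- t i ℤ.* (d₀ ℤ.+ σ ℤ.* dᵢ)))
        ≡⟨ cancel (net e′ t u) (t i) d₀ dᵢ σ ⟩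
      net e′ t u
        ≡⟨ t-circ u ⟩
      0ℤ ∎
      where
      open ≡-Reasoning
      d₀ = ∂ (e zero) u
      dᵢ = ∂ eᵢ u
      cancel : ∀ N t d₀ dᵢ σ →
        t ℤ.* d₀ ℤ.+ (N ℤ.+ (σ ℤ.* t ℤ.* dᵢ ℤ.- t ℤ.* (d₀ ℤ.+ σ ℤ.* dᵢ))) ≡ N
      cancel = solve-∀

-- The embedding of the integers into the ordered field

module _ {c ℓ₁ ℓ₂ : Level} (R : OrderedField c ℓ₁ ℓ₂) where

  open OrderedField R hiding (refl; sym; trans)
  private
    module R = OrderedField R
    module Σ = CMSum +-commutativeMonoid
  open SetoidReasoning setoid
  open Mult +-monoid using (×-homo-+)
  open GroupProperties +-group using (ε⁻¹≈ε)
  open AbelianGroupProperties +-abelianGroup using (⁻¹-∙-comm)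
  open CommutativeSemigroupProperties +-commutativeSemigroup using (interchange)

  -- Sums of integers of opposite sign compute to `⊖`, so this is the mixed case of `fromℤ-+`. The
  -- induction inserts `1# - 1#` to supply both successors.
  fromℤ-⊖ : ∀ m n → fromℤ (m ⊖ n) ≈ m · 1# - n · 1#
  fromℤ-⊖ zero    zero    = R.sym (-‿inverseʳ 0#)
  fromℤ-⊖ zero    (suc n) = R.sym (+-identityˡ _)
  fromℤ-⊖ (suc m) zero    = R.sym (R.trans (+-congˡ ε⁻¹≈ε) (+-identityʳ _))
  fromℤ-⊖ (suc m) (suc n) = begin
    fromℤ (suc m ⊖ suc n)                 ≡⟨ cong fromℤ (ℤ.[1+m]⊖[1+n]≡m⊖n m n) ⟩
    fromℤ (m ⊖ n)                         ≈⟨ fromℤ-⊖ m n ⟩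
    m · 1# - n · 1#                       ≈⟨ +-identityˡ _ ⟨
    0# + (m · 1# - n · 1#)                ≈⟨ +-congʳ (-‿inverseʳ 1#) ⟨
    (1# - 1#) + (m · 1# - n · 1#)         ≈⟨ interchange _ _ _ _ ⟩
    (1# + m · 1#) + (- 1# - n · 1#)       ≈⟨ +-congˡ (⁻¹-∙-comm _ _) ⟩
    suc m · 1# - suc n · 1#               ∎

  fromℤ-+ : ∀ x y → fromℤ (x ℤ.+ y) ≈ fromℤ x + fromℤ y
  fromℤ-+ (+ m)    (+ n)    = ×-homo-+ 1# m n
  fromℤ-+ (+ m)    -[1+ n ] = fromℤ-⊖ m (suc n)
  fromℤ-+ -[1+ m ] (+ n)    = R.trans (fromℤ-⊖ n (suc m)) (+-comm _ _)
  fromℤ-+ -[1+ m ] -[1+ n ] = begin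
    - (suc (suc (m ℕ.+ n)) · 1#)          ≡⟨ cong (λ k → - (suc k · 1#)) (ℕ.+-suc m n) ⟨
    - ((suc m ℕ.+ suc n) · 1#)            ≈⟨ -‿cong (×-homo-+ 1# (suc m) (suc n)) ⟩
    - (suc m · 1# + suc n · 1#)           ≈⟨ ⁻¹-∙-comm _ _ ⟨
    - (suc m · 1#) - suc n · 1#           ∎

  -- Circulations and their costs on a graph

  module _ (G : Graph R) where

    open Graph G

    ends : Edge → Fin #V × Fin #V
    ends e = src e , tgt e

    -- Passes from conditional sums to the linear `net`. It holds edge by edge; a loop at `v` counts
    -- in both flows and has zero incidence.
    inflow≡outflow+net : ∀ Y v → inflow Y v ≡ outflow Y v ℤ.+ net ends Y v
    inflow≡outflow+net Y v =
      trans (sum-cong-≗ λ e → split (does (tgt e ≟ v)) (does (src e ≟ v)) (Y e))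
            (∑-distrib-+ (λ e → if does (src e ≟ v) then Y e else 0ℤ) (λ e → Y e ℤ.* ∂ (ends e) v))
      where
      split : ∀ (p q : Bool) y → (if p then y else 0ℤ) ≡
        (if q then y else 0ℤ) ℤ.+ y ℤ.* ((if p then 1ℤ else 0ℤ) ℤ.- (if q then 1ℤ else 0ℤ))
      split true  true  y = sym (trans (cong (ℤ._+_ y) (ℤ.*-zeroʳ y)) (ℤ.+-identityʳ y))
      split true  false y = sym (trans (ℤ.+-identityˡ _) (ℤ.*-identityʳ y))
      split false true  y = cancel y
        where
        cancel : ∀ y → 0ℤ ≡ y ℤ.+ y ℤ.* -1ℤ
        cancel = solve-∀
      split false false y = sym (trans (ℤ.+-identityˡ _) (ℤ.*-zeroʳ y))

    circulation⇒net≡0 : ∀ {Y} → IsCirculation Y → ∀ v → net ends Y v ≡ 0ℤ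
    circulation⇒net≡0 {Y} circ v = GroupProperties.∙-cancelˡ (AbelianGroup.group ℤ.+-0-abelianGroup) (outflow Y v) _ _
      (trans (sym (inflow≡outflow+net Y v)) (trans (circ v) (sym (ℤ.+-identityʳ _))))

    net≡0⇒circulation : ∀ {Y} → (∀ v → net ends Y v ≡ 0ℤ) → IsCirculation Y
    net≡0⇒circulation {Y} eq v = trans (inflow≡outflow+net Y v)
      (trans (cong (ℤ._+_ (outflow Y v)) (eq v)) (ℤ.+-identityʳ _))

    -- The net flow of `A` doubles to that of `Y`, which is 0, and doubling is injective on the
    -- integers.
    circulation-half : ∀ {A Y} → (∀ e → A e ℤ.+ A e ≡ Y e) → IsCirculation Y → IsCirculation A
    circulation-half {A} {Y} 2A≡Y Y-circ = net≡0⇒circulation λ v →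
      double-zero _ (trans (sym (net-+ ends A A v))
        (trans (sum-cong-≗ λ e → cong (ℤ._* ∂ (ends e) v) (2A≡Y e)) (circulation⇒net≡0 Y-circ v)))
      where
      double-zero : ∀ a → a ℤ.+ a ≡ 0ℤ → a ≡ 0ℤ
      double-zero (+ zero) _ = refl

    circulation-+ : ∀ {Y Z} → IsCirculation Y → IsCirculation Z → IsCirculation (λ e → Y e ℤ.+ Z e)
    circulation-+ {Y} {Z} Y-circ Z-circ = net≡0⇒circulation λ v →
      trans (net-+ ends Y Z v) (cong₂ ℤ._+_ (circulation⇒net≡0 Y-circ v) (circulation⇒net≡0 Z-circ v))

    -- Additivity suffices: the net flows of `Y` and of its negative add up to that of 0, and the
    -- first vanishes.
    circulation-neg : ∀ {Y} → IsCirculation Y → IsCirculation (λ e → ℤ.- Y e)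
    circulation-neg {Y} Y-circ = net≡0⇒circulation λ v →
      trans (sym (ℤ.+-identityˡ _))
      (trans (cong (ℤ._+ net ends (ℤ.-_ ∘ Y) v) (sym (circulation⇒net≡0 Y-circ v)))
      (trans (sym (net-+ ends Y (ℤ.-_ ∘ Y) v))
      (trans (sum-cong-≗ λ e → cong (ℤ._* ∂ (ends e) v) (ℤ.+-inverseʳ (Y e)))
             (sum-replicate-zero #E))))

    c̃-cong : ∀ {Y Z} → (∀ e → Y e ≡ Z e) → c̃ Y ≈ c̃ Z
    c̃-cong Y≗Z = Σ.sum-cong-≋ λ e → *-congˡ (reflexive (cong fromℤ (Y≗Z e)))

    c̃-+ : ∀ Y Z → c̃ (λ e → Y e ℤ.+ Z e) ≈ c̃ Y + c̃ Z
    c̃-+ Y Z = R.trans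
      (Σ.sum-cong-≋ λ e → R.trans (*-congˡ (fromℤ-+ (Y e) (Z e))) (distribˡ _ _ _))
      (Σ.∑-distrib-+ (λ e → cost e * fromℤ (Y e)) (λ e → cost e * fromℤ (Z e)))

    c̃-neg : ∀ Y → c̃ Y + c̃ (ℤ.-_ ∘ Y) ≈ 0#
    c̃-neg Y = begin
      c̃ Y + c̃ (ℤ.-_ ∘ Y)               ≈⟨ c̃-+ Y (ℤ.-_ ∘ Y) ⟨
      c̃ (λ e → Y e ℤ.- Y e)             ≈⟨ c̃-cong (λ e → ℤ.+-inverseʳ (Y e)) ⟩
      c̃ (const 0ℤ)                      ≈⟨ Σ.sum-cong-≋ (λ e → zeroʳ (cost e)) ⟩
      Σ.sum {#E} (const 0#)             ≈⟨ Σ.sum-replicate-zero #E ⟩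
      0#                                ∎

    cheap-rounding : ∀ {Y} → IsCirculation Y →
      ∃[ s ] IsCirculation s × (∀ e → s e Rounds Y e) × c̃ s ≤ 0#
    cheap-rounding {Y} Y-circ
      with eulerian ends Y (λ v → divides 0ℤ (circulation⇒net≡0 Y-circ v))
    ... | s , s-rounds , s-net with IsTotalOrder.total isTotalOrder (c̃ s) 0#
    ...   | inj₁ c̃s≤0 = s , net≡0⇒circulation s-net , s-rounds , c̃s≤0
    ...   | inj₂ 0≤c̃s = ℤ.-_ ∘ s , circulation-neg (net≡0⇒circulation s-net) , rounds-neg ∘ s-rounds , c̃-s≤0
      where
      -- Adding the cost of `- s` to both sides of `0# ≤ c̃ s` makes the right side 0.
      c̃-s≤0 : c̃ (ℤ.-_ ∘ s) ≤ 0#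
      c̃-s≤0 = IsTotalOrder.≤-respˡ-≈ isTotalOrder (+-identityˡ _)
        (IsTotalOrder.≤-respʳ-≈ isTotalOrder (c̃-neg s) (+-monoˡ-≤ (c̃ (ℤ.-_ ∘ s)) 0≤c̃s))

-- The decomposition of X into A and B

∣i∣≤1⇒-1≤i : ∀ {i} → ∣ i ∣ ℕ.≤ 1 → -1ℤ ℤ.≤ i
∣i∣≤1⇒-1≤i {+ _}          _         = ℤ.-≤+
∣i∣≤1⇒-1≤i { -[1+ zero ] } _        = ℤ.≤-refl
∣i∣≤1⇒-1≤i { -[1+ suc _ ] } (s≤s ())

-- Integrality closes the gap: a negative `i` has double at most -2.
-1≤i+i⇒0≤i : ∀ {i} → -1ℤ ℤ.≤ i ℤ.+ i → 0ℤ ℤ.≤ i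
-1≤i+i⇒0≤i {+ _}      _ = ℤ.+≤+ z≤n
-1≤i+i⇒0≤i { -[1+ _ ] } (ℤ.-≤- ())

lemma23 : {c ℓ₁ ℓ₂ : Level} (R : OrderedField c ℓ₁ ℓ₂) (G : Graph R) →
    let open OrderedField R
        open Graph G in
    (Σ[ C ∈ (Edge → ℕ) ] IsCirculation (λ e → + C e) × (∀ e → 1 ℕ.≤ C e)) →
    (mccc : Carrier) → IsMccc mccc →
    (X : Edge → ℤ) → IsCirculation X → ‖ X ‖ ℕ.≤ 1 →
    Σ[ A ∈ (Edge → ℤ) ] Σ[ B ∈ (Edge → ℤ) ]
      IsCirculation A × IsCirculation B ×
      (∀ e → 0ℤ ℤ.≤ A e × 0ℤ ℤ.≤ B e) ×
      (∀ e → X e ≡ A e ℤ.- B e) ×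
      c̃ A + c̃ B ≤ mccc
lemma23 R G _ mccc ((C , (C-circ , 1≤C) , c̃C≈mccc) , _) X X-circ ‖X‖≤1
  with cheap-rounding R G (circulation-+ R G C-circ X-circ)
... | s , s-circ , s-rounds , c̃s≤0 =
  A , B , A-circ , B-circ , nonneg , (λ e → difference (A e) (X e)) , cost-bound
  where
  open OrderedField R hiding (refl; sym; trans)
  open Graph G

  -- If s = Y + 2 q with Y = C + X, then (Y + s) / 2 = q + Y.
  A B : Edge → ℤ
  A e = ℤ.quotient (congruent (s-rounds e)) ℤ.+ (C e ℤ.+ X e)
  B e = A e ℤ.- X e

  difference : ∀ a x → x ≡ a ℤ.- (a ℤ.- x)
  difference = solve-∀

  2A : ∀ e → A e ℤ.+ A e ≡ (C e ℤ.+ X e) ℤ.+ s e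
  2A e = double (ℤ.quotient (congruent (s-rounds e))) (s e) (C e ℤ.+ X e) (ℤ._∣_.equality (congruent (s-rounds e)))
    where
    expand : ∀ q y → (q ℤ.+ y) ℤ.+ (q ℤ.+ y) ≡ q ℤ.* + 2 ℤ.+ (y ℤ.+ y)
    expand = solve-∀
    collect : ∀ s y → (s ℤ.- y) ℤ.+ (y ℤ.+ y) ≡ y ℤ.+ s
    collect = solve-∀
    double : ∀ q s y → s ℤ.- y ≡ q ℤ.* + 2 → (q ℤ.+ y) ℤ.+ (q ℤ.+ y) ≡ y ℤ.+ s
    double q s y eq = trans (expand q y) (trans (cong (ℤ._+ (y ℤ.+ y)) (sym eq)) (collect s y))

  2B : ∀ e → B e ℤ.+ B e ≡ (C e ℤ.- X e) ℤ.+ s e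
  2B e = trans (expand (A e) (X e)) (trans (cong (ℤ._- (X e ℤ.+ X e)) (2A e)) (collect (C e) (X e) (s e)))
    where
    expand : ∀ a x → (a ℤ.- x) ℤ.+ (a ℤ.- x) ≡ (a ℤ.+ a) ℤ.- (x ℤ.+ x)
    expand = solve-∀
    collect : ∀ c x s → ((c ℤ.+ x) ℤ.+ s) ℤ.- (x ℤ.+ x) ≡ (c ℤ.- x) ℤ.+ s
    collect = solve-∀

  -- `X` cancels. Writing `s` first matches `+-monoˡ-≤` in `cost-bound`, which replaces the left
  -- summand by 0.
  A+B : ∀ e → A e ℤ.+ B e ≡ s e ℤ.+ C e
  A+B e = trans (expand (A e) (X e)) (trans (cong (ℤ._- X e) (2A e)) (collect (C e) (X e) (s e)))
    where
    expand : ∀ a x → a ℤ.+ (a ℤ.- x) ≡ (a ℤ.+ a) ℤ.- x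
    expand = solve-∀
    collect : ∀ c x s → ((c ℤ.+ x) ℤ.+ s) ℤ.- x ≡ s ℤ.+ c
    collect = solve-∀

  A-circ : IsCirculation A
  A-circ = circulation-half R G 2A (circulation-+ R G (circulation-+ R G C-circ X-circ) s-circ)

  B-circ : IsCirculation B
  B-circ = circulation-+ R G A-circ (circulation-neg R G X-circ)

  ∣X∣≤1 : ∀ e → ∣ X e ∣ ℕ.≤ 1
  ∣X∣≤1 e = ℕ.≤-trans (All.tabulate⁻ {f = ∣_∣ ∘ X} (xs≤max 0 _) e) ‖X‖≤1

  nonneg : ∀ e → 0ℤ ℤ.≤ A e × 0ℤ ℤ.≤ B e
  nonneg e =
      half (2A e) (∣i∣≤1⇒-1≤i (∣X∣≤1 e))
    , half (2B e) (∣i∣≤1⇒-1≤i (subst (ℕ._≤ 1) (sym (ℤ.∣-i∣≡∣i∣ (X e))) (∣X∣≤1 e)))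
    where
    -- Serves both parts: `x` is `X e` for `A` and `- X e` for `B`. The three lower bounds 1, -1 and
    -- -1 add up to -1.
    half : ∀ {a x} → a ℤ.+ a ≡ (C e ℤ.+ x) ℤ.+ s e → -1ℤ ℤ.≤ x → 0ℤ ℤ.≤ a
    half eq -1≤x = -1≤i+i⇒0≤i (subst (-1ℤ ℤ.≤_) (sym eq)
      (ℤ.+-mono-≤ (ℤ.+-mono-≤ (1≤C e) -1≤x) (∣i∣≤1⇒-1≤i (small (s-rounds e)))))

  cost-bound : c̃ A + c̃ B ≤ mccc
  cost-bound = begin
    c̃ A + c̃ B                     ≈⟨ c̃-+ R G A B ⟨
    c̃ (λ e → A e ℤ.+ B e)         ≈⟨ c̃-cong R G A+B ⟩
    c̃ (λ e → s e ℤ.+ C e)         ≈⟨ c̃-+ R G s C ⟩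
    c̃ s + c̃ C                     ≤⟨ +-monoˡ-≤ (c̃ C) c̃s≤0 ⟩
    0# + c̃ C                      ≈⟨ +-identityˡ _ ⟩
    c̃ C                           ≈⟨ c̃C≈mccc ⟩
    mccc                          ∎
    where
    poset : Poset _ _ _
    poset = record { isPartialOrder = IsTotalOrder.isPartialOrder isTotalOrder }
    open PartialOrderReasoning poset
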